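{- Let $T$ be a tree. Then $\mathsf{TS}_3(T)$ is acyclic if and only if $T$ is $\{2K_2+K_1, D_{2,4,2}\}$-free.
   Context: Graphs are finite, simple and undirected. For a graph $G$ and an integer $k\ge 2$, $\mathsf{TS}_k(G)$ is the graph whose nodes are all size-$k$ independent sets of $G$, two nodes $I,J$ being adjacent if there are vertices $u,v$ of $G$ with $I\setminus J=\{u\}$, $J\setminus I=\{v\}$ and $uv\in E(G)$. (A graph with no nodes counts as acyclic.) $+$ denotes disjoint union and $2K_2$ is the disjoint union of two copies of $K_2$. For integers $n,r,s\ge 1$, $D_{r,n,s}$ is the tree obtained from the path $P_n$ on $n$ vertices by attaching $r$ leaves to one end vertex and $s$ leaves to the other end vertex. A graph is $\mathcal{F}$-free if it contains no member of $\mathcal{F}$ as an induced subgraph (up to isomorphism). -}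

module Defs where

import Data.Bool.Properties as Bool
open import Data.Empty using (⊥)
open import Data.Fin using (Fin; zero; suc; toℕ; fromℕ; fromℕ<; inject₁; opposite)
import Data.Fin.Properties as Fin
open import Data.Fin.Subset using (Subset; _∈_; _─_; ⁅_⁆; ∣_∣)
open import Data.Fin.Subset.Properties using (x∈⁅x⁆; x∈⁅y⁆⇒x≡y)
open import Data.List using (List)
open import Data.List.Relation.Unary.All using (All)
open import Data.Nat using (ℕ; suc; NonZero; >-nonZero⁻¹)
import Data.Nat.Properties as ℕ
open import Data.Product using (Σ; ∃₂; _×_; _,_; proj₂)
open import Data.Refinement using (Refinement-syntax; value)
open import Data.Sum using (_⊎_; inj₁; inj₂)
import Data.Sum.Properties as Sum
open import Data.Sum.Relation.Binary.Pointwise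
  using (Pointwise; inj₁; inj₂; ⊎-symmetric; ⊎-decidable)
import Data.Vec.Properties as Vec
open import Function using (_⇔_)
open import Function.Definitions using (Injective)
open import Relation.Binary.Construct.Closure.ReflexiveTransitive using (Star)
open import Relation.Binary.Construct.Closure.Symmetric using (SymClosure; fwd; bwd; symmetric)
open import Relation.Binary.Core using (Rel)
open import Relation.Binary.Definitions using (Symmetric; Irreflexive; Decidable)
open import Relation.Binary.PropositionalEquality using (_≡_; _≢_; refl; sym; trans; subst; ≢-sym)
open import Relation.Nullary using (¬_; Dec; yes; no)
open import Relation.Nullary.Decidable using (map′; ¬?; _×-dec_; _⊎-dec_)

-- Finite graphs are taken on the vertex set Fin n.  Other vertex types
-- occur as nodes of TS and in the explicit forbidden subgraphs.
record Graph (V : Set) : Set₁ where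
  infix 4 _~_ _~?_
  field
    _~_      : Rel V _
    ~-sym    : Symmetric _~_
    ~-irrefl : Irreflexive _≡_ _~_
    _~?_     : Decidable _~_

record Cycle {V : Set} (G : Graph V) : Set where
  open Graph G
  field
    excess    : ℕ   -- the cycle has 3 + excess vertices
    vertex    : Fin (suc (suc (suc excess))) → V
    injective : Injective _≡_ _≡_ vertex
    step      : ∀ i → vertex (inject₁ i) ~ vertex (suc i)
    closing   : vertex (fromℕ _) ~ vertex zero

Acyclic : {V : Set} → Graph V → Set
Acyclic G = ¬ Cycle G

-- Connected graphs are required to be nonempty.
Connected : {V : Set} → Graph V → Set
Connected {V} G = V × (∀ u v → Star (Graph._~_ G) u v)

IsTree : {V : Set} → Graph V → Set
IsTree G = Connected G × Acyclic G

-- An isomorphism from H onto the subgraph of G induced by the image of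
-- the embedding.
record InducedEmbedding {W V : Set} (H : Graph W) (G : Graph V) : Set where
  private
    module H = Graph H
    module G = Graph G
  field
    embed     : W → V
    injective : Injective _≡_ _≡_ embed
    adjacency : ∀ u v → u H.~ v ⇔ embed u G.~ embed v

-- The second argument is free of every graph in the first.
_-Free_ : {V : Set} → List (Σ Set Graph) → Graph V → Set₁
𝓕 -Free G = All (λ H → ¬ InducedEmbedding (proj₂ H) G) 𝓕

K : ∀ n → Graph (Fin n)
K n = record
  { _~_      = _≢_
  ; ~-sym    = ≢-sym
  ; ~-irrefl = λ u≡v u≢v → u≢v u≡v
  ; _~?_     = λ u v → ¬? (u Fin.≟ v)
  }

P : ∀ n → Graph (Fin n)
P n = record
  { _~_      = SymClosure Next
  ; ~-sym    = symmetric Next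
  ; ~-irrefl = λ { refl (fwd e) → ℕ.1+n≢n (sym e) ; refl (bwd e) → ℕ.1+n≢n (sym e) }
  ; _~?_     = λ u v → map′ (λ { (inj₁ e) → fwd e ; (inj₂ e) → bwd e })
                            (λ { (fwd e) → inj₁ e ; (bwd e) → inj₂ e })
                            (next? u v ⊎-dec next? v u)
  }
  where
  Next : Rel (Fin n) _
  Next i j = toℕ j ≡ suc (toℕ i)

  next? : Decidable Next
  next? i j = toℕ j ℕ.≟ suc (toℕ i)

infixr 6 _+_

_+_ : {V W : Set} → Graph V → Graph W → Graph (V ⊎ W)
G + H = record
  { _~_      = Pointwise G._~_ H._~_
  ; ~-sym    = ⊎-symmetric G.~-sym H.~-sym
  ; ~-irrefl = λ { refl (inj₁ e) → G.~-irrefl refl e ; refl (inj₂ e) → H.~-irrefl refl e }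
  ; _~?_     = ⊎-decidable G._~?_ H._~?_
  }
  where
  module G = Graph G
  module H = Graph H

attachLeaves : {V : Set} → Graph V → (∀ u v → Dec (u ≡ v)) → V → ∀ r → Graph (V ⊎ Fin r)
attachLeaves {V} G _≟_ c r = record
  { _~_      = Adj
  ; ~-sym    = λ {x} {y} → adj-sym x y
  ; ~-irrefl = λ { {x} refl → adj-irrefl x }
  ; _~?_     = adj?
  }
  where
  module G = Graph G

  Adj : Rel (V ⊎ Fin r) _
  Adj (inj₁ u) (inj₁ v) = u G.~ v
  Adj (inj₁ u) (inj₂ _) = u ≡ c
  Adj (inj₂ _) (inj₁ v) = v ≡ c
  Adj (inj₂ _) (inj₂ _) = ⊥

  adj-sym : ∀ x y → Adj x y → Adj y x
  adj-sym (inj₁ _) (inj₁ _) e = G.~-sym e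
  adj-sym (inj₁ _) (inj₂ _) e = e
  adj-sym (inj₂ _) (inj₁ _) e = e

  adj-irrefl : ∀ x → ¬ Adj x x
  adj-irrefl (inj₁ _) e = G.~-irrefl refl e

  adj? : Decidable Adj
  adj? (inj₁ u) (inj₁ v) = u G.~? v
  adj? (inj₁ u) (inj₂ _) = u ≟ c
  adj? (inj₂ _) (inj₁ v) = v ≟ c
  adj? (inj₂ _) (inj₂ _) = no λ ()

2K₂+K₁ : Graph ((Fin 2 ⊎ Fin 2) ⊎ Fin 1)
2K₂+K₁ = (K 2 + K 2) + K 1

-- The leaves are attached to the first and to the last vertex of P n;
-- these coincide when n is 1.
D : (r n s : ℕ) .{{_ : NonZero n}} → Graph ((Fin n ⊎ Fin r) ⊎ Fin s)
D r n s = attachLeaves (attachLeaves (P n) Fin._≟_ first r) _≟_ (inj₁ (opposite first)) s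
  where
  first : Fin n
  first = fromℕ< (>-nonZero⁻¹ n)

  _≟_ : (x y : Fin n ⊎ Fin r) → Dec (x ≡ y)
  _≟_ = Sum.≡-dec Fin._≟_ Fin._≟_

Independent : ∀ {n} → Graph (Fin n) → Subset n → Set
Independent G S = ∀ u v → u ∈ S → v ∈ S → ¬ u ~ v
  where open Graph G

-- The conditions on the underlying set are irrelevant, so nodes are
-- equal exactly when the underlying sets are.
IndependentSet : ∀ {n} → Graph (Fin n) → ℕ → Set
IndependentSet {n} G k = [ S ∈ Subset n ∣ ∣ S ∣ ≡ k × Independent G S ]

TS : ∀ {n} (k : ℕ) (G : Graph (Fin n)) → Graph (IndependentSet G k)
TS {n} k G = record
  { _~_      = λ I J → Slide (value I) (value J)
  ; ~-sym    = λ (u , v , I─J , J─I , u~v) → v , u , J─I , I─J , ~-sym u~v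
  ; ~-irrefl = λ { {I} refl (u , v , I─J , J─I , u~v) → ~-irrefl (⁅⁆-injective u v (trans (sym I─J) J─I)) u~v }
  ; _~?_     = λ I J → slide? (value I) (value J)
  }
  where
  open Graph G

  Slide : Rel (Subset n) _
  Slide I J = ∃₂ λ u v → I ─ J ≡ ⁅ u ⁆ × J ─ I ≡ ⁅ v ⁆ × u ~ v

  ⁅⁆-injective : ∀ u v → ⁅ u ⁆ ≡ ⁅ v ⁆ → u ≡ v
  ⁅⁆-injective u v e = x∈⁅y⁆⇒x≡y v (subst (u ∈_) e (x∈⁅x⁆ u))

  _≟_ : (S T : Subset n) → Dec (S ≡ T)
  _≟_ = Vec.≡-dec Bool._≟_

  slide? : Decidable Slide
  slide? I J = Fin.any? λ u → Fin.any? λ v →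
    ((I ─ J) ≟ ⁅ u ⁆) ×-dec ((J ─ I) ≟ ⁅ v ⁆) ×-dec (u ~? v)

{-# OPTIONS --safe #-}

-- Follow the tokens along a cycle of TS₃(T).  If a token moves u → v and right
-- after it another one moves x → x′, then u ~ x′, as otherwise the two edges and
-- the third token induce 2K₂ + K₁; so v u x′ x is a path of T.  Looking at most
-- two moves back and two moves ahead of such a turn, every choice of moving
-- tokens yields a closed non-backtracking walk in T, an induced 2K₂ + K₁ or an
-- induced D₂,₄,₂.  Hence a single token makes all the moves, and it traces a
-- closed non-backtracking walk in T, which is impossible in a tree.
-- Conversely, each of the two forbidden graphs carries an explicit closed walk of
-- three tokens, which an embedding transports to T.
module Submission where

open import Defs
open import Data.Empty using (⊥; ⊥-elim; ⊥-elim-irr)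
open import Data.Fin using (Fin; zero; suc; toℕ; fromℕ; inject₁; inject≤)
import Data.Fin.Properties as Fin
open import Data.Fin.Relation.Unary.Top using (view; ‵fromℕ; ‵inject₁)
import Data.Fin.Subset as Subset
open import Data.Fin.Subset using (Subset; _─_; ⁅_⁆; _∪_; ∣_∣; inside; outside)
import Data.Fin.Subset.Properties as Subset
open import Data.Irrelevant using ([_])
open import Data.List using (List; _∷_; []; _++_; map; length; lookup; filter; allFin; applyUpTo)
import Data.List.Membership.DecPropositional as DecMembership
open import Data.List.Membership.Propositional using (_∈_; _∉_; find; lose)
open import Data.List.Membership.Propositional.Properties
  using (∈-lookup; ∈-map⁺; ∈-map⁻; ∈-++⁺ʳ; ∈-applyUpTo⁺; ∈-filter⁺; ∈-filter⁻; ∈-allFin)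
open import Data.List.Properties using (≡-dec; length-map)
open import Data.List.Relation.Unary.All as All using (All; []; _∷_)
import Data.List.Relation.Unary.All.Properties as All
open import Data.List.Relation.Unary.All.Properties using (¬Any⇒All¬; All¬⇒¬Any)
open import Data.List.Relation.Unary.AllPairs as AllPairs using (AllPairs; []; _∷_)
import Data.List.Relation.Unary.AllPairs.Properties as AllPairs
open import Data.List.Relation.Unary.Any as Any using (Any; here; there; index)
open import Data.List.Relation.Unary.Any.Properties using (lookup-index)
open import Data.List.Relation.Unary.Unique.Propositional using (Unique)
import Data.List.Relation.Unary.Unique.Propositional.Properties as Unique
import Data.Nat as ℕ
open import Data.Nat using (ℕ; zero; suc; s≤s; _∸_; _<_)
import Data.Nat.Properties as ℕ
open import Data.Product using (Σ; ∃; ∃₂; _×_; _,_; proj₁; proj₂)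
open import Data.Refinement using (value; _,_)
open import Data.Sum as Sum using (_⊎_; inj₁; inj₂; [_,_]′)
import Data.Sum.Properties as Sum
open import Data.Sum.Relation.Binary.Pointwise using (inj₁; inj₂)
import Data.Vec as Vec
open import Data.Vec using (_∷_; []; here; there)
open import Function using (_⇔_; mk⇔; _∘_; Equivalence)
open import Function.Definitions using (Injective)
open import Relation.Binary.Construct.Closure.ReflexiveTransitive using (Star; ε; _◅_; _◅◅_; gmap; reverse)
open import Relation.Binary.Construct.Closure.Symmetric using (fwd; bwd)
open import Relation.Binary.Core using (Rel)
open import Relation.Binary.Definitions using (Decidable; DecidableEquality)
open import Relation.Binary.PropositionalEquality using (_≡_; _≢_; refl; sym; trans; cong; subst; ≢-sym)
open import Relation.Nullary using (¬_; Dec; yes; no; contradiction; recompute)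
open import Relation.Nullary.Decidable using (map′; ¬?; _×-dec_; _⊎-dec_; True; toWitness)

-- Non-backtracking walks in acyclic graphs

-- Walks without immediate backtracking, consecutive vertices being related by R
-- and vertices two steps apart by N.
data Trail {A : Set} (R N : Rel A _) : List A → Set where
  [_] : ∀ {x y} → R x y → Trail R N (x ∷ y ∷ [])
  _∷_ : ∀ {x y z zs} → R x y × N x z → Trail R N (y ∷ z ∷ zs) → Trail R N (x ∷ y ∷ z ∷ zs)

infixr 5 _∷_

lookup-injective : {A : Set} {xs : List A} → Unique xs → Injective _≡_ _≡_ (lookup xs)
lookup-injective (x∉ ∷ u) {zero}  {zero}  _ = refl
lookup-injective (x∉ ∷ u) {zero}  {suc j} e = contradiction e (All.lookup x∉ (∈-lookup j))
lookup-injective (x∉ ∷ u) {suc i} {zero}  e = contradiction (sym e) (All.lookup x∉ (∈-lookup i))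
lookup-injective (x∉ ∷ u) {suc i} {suc j} e = cong suc (lookup-injective u e)

lookup-consecutive : {A : Set} {R N : Rel A _} {xs : List A} → Trail R N xs →
  ∀ i j → toℕ j ≡ suc (toℕ i) → R (lookup xs i) (lookup xs j)
lookup-consecutive [ r ]         zero    (suc zero) _ = r
lookup-consecutive ((r , _) ∷ t) zero    (suc zero) _ = r
lookup-consecutive [ _ ]         (suc zero) (suc zero) ()
lookup-consecutive (_ ∷ t)       (suc i) (suc j)    e = lookup-consecutive t i j (ℕ.suc-injective e)

module _ {V : Set} (G : Graph V) where
  open Graph G

  GraphTrail : List V → Set
  GraphTrail = Trail _~_ _≢_

  -- The cycle is the part of `ys` up to the occurrence of `x`, closed by the first edge of the
  -- trail. Irreflexivity keeps `x` from the first place of `ys` and the ban on backtracking from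
  -- the second, so there are at least three vertices.
  closed-trail⇒cycle : ∀ {x ys} → GraphTrail (x ∷ ys) → Unique ys → x ∈ ys → Cycle G
  closed-trail⇒cycle [ e ] _ (here refl) = contradiction e (~-irrefl refl)
  closed-trail⇒cycle ((e , _) ∷ _) _ (here refl) = contradiction e (~-irrefl refl)
  closed-trail⇒cycle ((_ , ne) ∷ _) _ (there (here refl)) = contradiction refl ne
  closed-trail⇒cycle {x} {ys} ((e , _) ∷ t) u x∈@(there (there x∈zs)) = record
    { excess    = toℕ (index x∈zs)
    ; vertex    = λ i → lookup ys (inject≤ i short)
    ; injective = λ {i} {j} eq → Fin.inject≤-injective short short i j (lookup-injective u eq)
    ; step      = λ i → lookup-consecutive t _ _ (trans (Fin.toℕ-inject≤ (suc i) short)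
                    (cong suc (sym (trans (Fin.toℕ-inject≤ (inject₁ i) short) (Fin.toℕ-inject₁ i)))))
    ; closing   = subst (_~ _) (trans (lookup-index x∈) (cong (lookup ys) last)) e
    }
    where
    short = s≤s (s≤s (Fin.toℕ<n (index x∈zs)))
    last : index x∈ ≡ inject≤ (fromℕ _) short
    last = Fin.toℕ-injective (sym (trans (Fin.toℕ-inject≤ (fromℕ _) short) (Fin.toℕ-fromℕ _)))

  module _ (acyclic : Acyclic G) where

    -- The two are proved together: freshness of the head needs the rest of the trail to be
    -- repetition-free in order to cut out a cycle, and that follows from freshness along the
    -- shorter trails.
    trail-fresh  : ∀ {x ys} → GraphTrail (x ∷ ys) → x ∉ ys
    trail-unique : ∀ {x ys} → GraphTrail (x ∷ ys) → Unique ys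

    trail-fresh t x∈ys = acyclic (closed-trail⇒cycle t (trail-unique t) x∈ys)

    trail-unique [ _ ]   = [] ∷ []
    trail-unique (_ ∷ t) = ¬Any⇒All¬ _ (trail-fresh t) ∷ trail-unique t

    -- A chord could be put in front of the trail as a first step from `w` to `x`. Freshness makes
    -- `w` differ from `y`, so the result is again a trail, and it revisits `w`.
    trail-chordless : ∀ {x y zs w} → GraphTrail (x ∷ y ∷ zs) → w ∈ zs → ¬ x ~ w
    trail-chordless t@(_ ∷ t′) w∈zs x~w =
      trail-fresh ((~-sym x~w , λ w≡y → trail-fresh t′ (subst (_∈ _) w≡y w∈zs)) ∷ t) (there (there w∈zs))

-- Locally injective homomorphisms and induced embeddings

module _ {W V : Set} (H : Graph W) (G : Graph V) where
  private
    module H = Graph H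
    module G = Graph G

  -- Local injectivity is exactly what makes the image of a trail a trail. Into an acyclic graph it
  -- already forces an induced embedding when the source is connected, so only vertices two steps
  -- apart have to be compared.
  record Immersion : Set where
    field
      vertexMap    : W → V
      homomorphism : ∀ u v → u H.~ v → vertexMap u G.~ vertexMap v
      locally-inj  : ∀ {u v w} → u H.~ v → v H.~ w → u ≢ w → vertexMap u ≢ vertexMap w

private
  variable
    V W : Set
    G G₁ G₂ : Graph V
    H : Graph W

-- Edges are added in front one at a time. If a new edge backtracks, it cancels against the first
-- edge of the trail built so far.
joining-trail : (G : Graph V) → DecidableEquality V →
  ∀ {u v} → Star (Graph._~_ G) u v → u ≡ v ⊎ ∃ λ ys → GraphTrail G (u ∷ ys) × v ∈ ys
joining-trail G _≟_ ε = inj₁ refl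
joining-trail G _≟_ {u} {v} (e ◅ es) with joining-trail G _≟_ es
... | inj₁ refl = inj₂ (_ , [ e ] , here refl)
... | inj₂ (z ∷ zs , t , v∈) with u ≟ z
...   | no u≢z = inj₂ (_ , (e , u≢z) ∷ t , there v∈)
joining-trail G _≟_ (e ◅ es) | inj₂ (_ , t , here refl) | yes refl = inj₁ refl
joining-trail G _≟_ (e ◅ es) | inj₂ (_ , _ ∷ t , there v∈) | yes refl = inj₂ (_ , t , v∈)

immerse-trail : (φ : Immersion H G) → ∀ {xs} → GraphTrail H xs → GraphTrail G (map (Immersion.vertexMap φ) xs)
immerse-trail φ [ e ] = [ Immersion.homomorphism φ _ _ e ]
immerse-trail φ ((e , n) ∷ t) = (homomorphism _ _ e , locally-inj e (first-edge t) n) ∷ immerse-trail φ t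
  where
  open Immersion φ
  first-edge : ∀ {A R N} {y z : A} {zs} → Trail R N (y ∷ z ∷ zs) → R y z
  first-edge [ r ] = r
  first-edge ((r , _) ∷ _) = r

-- A trail joining two vertices of `H` is mapped to a trail of `G`. Freshness of the image separates
-- its ends, and chordlessness leaves them adjacent only if the trail has a single edge.
immersion⇒embedding : {W V : Set} {H : Graph W} {G : Graph V} → Connected H → DecidableEquality W → Acyclic G →
  Immersion H G → InducedEmbedding H G
immersion⇒embedding {H = H} {G = G} (_ , connected) _≟_ acyclic φ = record
  { embed     = vertexMap
  ; injective = λ {u} {v} → injective u v
  ; adjacency = λ u v → mk⇔ (homomorphism u v) (reflects u v)
  }
  where
  open Immersion φ
  injective : ∀ u v → vertexMap u ≡ vertexMap v → u ≡ v
  injective u v eq with joining-trail H _≟_ (connected u v)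
  ... | inj₁ u≡v = u≡v
  ... | inj₂ (ys , t , v∈) =
    contradiction (subst (_∈ map vertexMap ys) (sym eq) (∈-map⁺ vertexMap v∈)) (trail-fresh G acyclic (immerse-trail φ t))
  reflects : ∀ u v → Graph._~_ G (vertexMap u) (vertexMap v) → Graph._~_ H u v
  reflects u v e with joining-trail H _≟_ (connected u v)
  ... | inj₁ refl = contradiction e (Graph.~-irrefl G refl)
  ... | inj₂ (_ , [ e′ ] , here refl) = e′
  ... | inj₂ (_ , (e′ , _) ∷ _ , here refl) = e′
  ... | inj₂ (_ , t@(_ ∷ _) , there v∈) =
    contradiction e (trail-chordless G acyclic (immerse-trail φ t) (∈-map⁺ vertexMap v∈))

module _ {W : Set} {H : Graph W} {_≟_ : DecidableEquality W} {c : W} {r : ℕ} where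

  attachLeaves-connected : Connected H → Connected (attachLeaves H _≟_ c r)
  attachLeaves-connected (v₀ , connected) = inj₁ v₀ , joined
    where
    inner : ∀ u v → Star (Graph._~_ (attachLeaves H _≟_ c r)) (inj₁ u) (inj₁ v)
    inner u v = gmap inj₁ (λ e → e) (connected u v)
    joined : ∀ u v → Star (Graph._~_ (attachLeaves H _≟_ c r)) u v
    joined (inj₁ u) (inj₁ v) = inner u v
    joined (inj₁ u) (inj₂ _) = inner u c ◅◅ refl ◅ ε
    joined (inj₂ _) (inj₁ v) = refl ◅ inner c v
    joined (inj₂ _) (inj₂ _) = _◅_ {j = inj₁ c} refl (refl ◅ ε)

  -- The new two-step walks between distinct vertices all have `c` in the middle. They join two
  -- leaves or a leaf and an old neighbour of `c`, which is why the leaves need only avoid the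
  -- images of those neighbours.
  attachLeaves-immersion : (φ : Immersion H G) (leaf : Fin r → V) → Injective _≡_ _≡_ leaf →
    (∀ i → Graph._~_ G (Immersion.vertexMap φ c) (leaf i)) →
    (∀ i u → Graph._~_ H u c → Immersion.vertexMap φ u ≢ leaf i) →
    Immersion (attachLeaves H _≟_ c r) G
  attachLeaves-immersion {G = G} φ leaf leaf-inj c~leaf leaf-new = record
    { vertexMap    = [ vertexMap , leaf ]′
    ; homomorphism = hom
    ; locally-inj  = λ {u} {v} {w} → loc u v w
    }
    where
    open Immersion φ
    open Graph G
    H⁺ = attachLeaves H _≟_ c r
    hom : ∀ u v → Graph._~_ H⁺ u v → [ vertexMap , leaf ]′ u ~ [ vertexMap , leaf ]′ v
    hom (inj₁ u) (inj₁ v) e    = homomorphism u v e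
    hom (inj₁ _) (inj₂ i) refl = c~leaf i
    hom (inj₂ i) (inj₁ _) refl = ~-sym (c~leaf i)
    loc : ∀ u v w → Graph._~_ H⁺ u v → Graph._~_ H⁺ v w → u ≢ w → [ vertexMap , leaf ]′ u ≢ [ vertexMap , leaf ]′ w
    loc (inj₁ u) (inj₁ v) (inj₁ w) e f    n = locally-inj e f (n ∘ cong inj₁)
    loc (inj₁ u) (inj₁ _) (inj₂ i) e refl n = leaf-new i u e
    loc (inj₂ i) (inj₁ _) (inj₁ w) refl f n = leaf-new i w (Graph.~-sym H f) ∘ sym
    loc (inj₂ i) (inj₁ v) (inj₂ j) e f    n = n ∘ cong inj₂ ∘ leaf-inj
    loc (inj₁ _) (inj₂ _) (inj₁ _) refl refl n = contradiction refl n

+-embedding : (E : InducedEmbedding G₁ G) (F : InducedEmbedding G₂ G) →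
  (∀ u v → InducedEmbedding.embed E u ≢ InducedEmbedding.embed F v) →
  (∀ u v → ¬ Graph._~_ G (InducedEmbedding.embed E u) (InducedEmbedding.embed F v)) →
  InducedEmbedding (G₁ + G₂) G
+-embedding {G₁ = G₁} {G = G} {G₂ = G₂} E F disjoint apart = record
  { embed     = em
  ; injective = λ {u} {v} → inj u v
  ; adjacency = adj
  }
  where
  open Graph G
  module E = InducedEmbedding E
  module F = InducedEmbedding F
  em = [ E.embed , F.embed ]′
  inj : ∀ u v → em u ≡ em v → u ≡ v
  inj (inj₁ u) (inj₁ v) e = cong inj₁ (E.injective e)
  inj (inj₁ u) (inj₂ v) e = contradiction e (disjoint u v)
  inj (inj₂ u) (inj₁ v) e = contradiction (sym e) (disjoint v u)
  inj (inj₂ u) (inj₂ v) e = cong inj₂ (F.injective e)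
  adj : ∀ u v → Graph._~_ (G₁ + G₂) u v ⇔ em u ~ em v
  adj (inj₁ u) (inj₁ v) = mk⇔ (λ { (inj₁ e) → Equivalence.to (E.adjacency u v) e })
                            (inj₁ ∘ Equivalence.from (E.adjacency u v))
  adj (inj₂ u) (inj₂ v) = mk⇔ (λ { (inj₂ e) → Equivalence.to (F.adjacency u v) e })
                            (inj₂ ∘ Equivalence.from (F.adjacency u v))
  adj (inj₁ u) (inj₂ v) = mk⇔ (λ ()) (λ e → contradiction e (apart u v))
  adj (inj₂ u) (inj₁ v) = mk⇔ (λ ()) (λ e → contradiction (~-sym e) (apart v u))

K-embedding : (G : Graph V) → ∀ {n} (f : Fin n → V) →
  (∀ i j → i ≢ j → Graph._~_ G (f i) (f j)) → InducedEmbedding (K n) G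
K-embedding G f adj = record
  { embed     = f
  ; injective = λ {i} {j} → inj i j
  ; adjacency = λ i j → mk⇔ (adj i j) (λ { e refl → ~-irrefl refl e })
  }
  where
  open Graph G
  inj : ∀ i j → f i ≡ f j → i ≡ j
  inj i j e with i Fin.≟ j
  ... | yes i≡j = i≡j
  ... | no i≢j  = contradiction (adj i j i≢j) (~-irrefl e)

P-connected : ∀ n → Connected (P (suc n))
P-connected n = zero , λ u v → reverse (Graph.~-sym (P (suc n))) (from-zero n u) ◅◅ from-zero n v
  where
  next : ∀ {n} {u v : Fin n} → Graph._~_ (P n) u v → Graph._~_ (P (suc n)) (suc u) (suc v)
  next (fwd e) = fwd (cong suc e)
  next (bwd e) = bwd (cong suc e)
  from-zero : ∀ n (v : Fin (suc n)) → Star (Graph._~_ (P (suc n))) zero v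
  from-zero n       zero    = ε
  from-zero (suc n) (suc v) = fwd refl ◅ gmap suc next (from-zero n v)

P-immersion : {V : Set} {G : Graph V} → ∀ {n} (f : Fin n → V) →
  (∀ i j → toℕ j ≡ suc (toℕ i) → Graph._~_ G (f i) (f j)) →
  (∀ i j → toℕ j ≡ suc (suc (toℕ i)) → f i ≢ f j) → Immersion (P n) G
P-immersion {G = G} {n} f next skip = record
  { vertexMap    = f
  ; homomorphism = λ { u v (fwd e) → next u v e ; u v (bwd e) → ~-sym (next v u e) }
  ; locally-inj  = λ {u} {v} {w} → loc u v w
  }
  where
  open Graph G
  loc : ∀ u v w → Graph._~_ (P n) u v → Graph._~_ (P n) v w → u ≢ w → f u ≢ f w
  loc u v w (fwd e) (fwd e′) _   = skip u w (trans e′ (cong suc e))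
  loc u v w (fwd e) (bwd e′) u≢w = contradiction (Fin.toℕ-injective (ℕ.suc-injective (trans (sym e) e′))) u≢w
  loc u v w (bwd e) (fwd e′) u≢w = contradiction (Fin.toℕ-injective (trans e (sym e′))) u≢w
  loc u v w (bwd e) (bwd e′) _   = ≢-sym (skip w u (trans e (cong suc e′)))

-- Token configurations, moves and permutations of the positions

module _ {V : Set} (G : Graph V) where
  open Graph G

  Apart : Rel V _
  Apart u v = u ≢ v × ¬ u ~ v

  Spread : List V → Set
  Spread = AllPairs Apart

  -- A token configuration lists the vertices occupied by the tokens, each
  -- token keeping its position in the list throughout a walk.
  data Slides : List V → List V → Set where
    slide : ∀ {u v xs} → u ~ v → Slides (u ∷ xs) (v ∷ xs)
    keep  : ∀ {x xs ys} → Slides xs ys → Slides (x ∷ xs) (x ∷ ys)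

  mover : ∀ {xs ys} → Slides xs ys → ℕ
  mover (slide _) = 0
  mover (keep s)  = suc (mover s)

  Apart-sym : ∀ {u v} → Apart u v → Apart v u
  Apart-sym (u≢v , u≁v) = ≢-sym u≢v , u≁v ∘ ~-sym

trail-map : {A B : Set} {R N : Rel A _} {R′ N′ : Rel B _} (f : A → B) →
  (∀ {x y} → R x y → R′ (f x) (f y)) → (∀ {x y} → N x y → N′ (f x) (f y)) →
  ∀ {xs} → Trail R N xs → Trail R′ N′ (map f xs)
trail-map f r n [ e ]           = [ r e ]
trail-map f r n ((e , e′) ∷ t) = (r e , n e′) ∷ trail-map f r n t

-- Together with `swapTail` this generates all permutations of three token positions.
swapHead : {A : Set} → List A → List A
swapHead (x ∷ y ∷ zs) = y ∷ x ∷ zs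
swapHead xs           = xs

swapTail : {A : Set} → List A → List A
swapTail []       = []
swapTail (x ∷ xs) = x ∷ swapHead xs

swapHead-involutive : {A : Set} (xs : List A) → swapHead (swapHead xs) ≡ xs
swapHead-involutive []           = refl
swapHead-involutive (_ ∷ [])     = refl
swapHead-involutive (_ ∷ _ ∷ _) = refl

swapTail-involutive : {A : Set} (xs : List A) → swapTail (swapTail xs) ≡ xs
swapTail-involutive []       = refl
swapTail-involutive (x ∷ xs) = cong (x ∷_) (swapHead-involutive xs)

involutive⇒distinct : {A : Set} {f : A → A} → (∀ x → f (f x) ≡ x) → ∀ {x y} → x ≢ y → f x ≢ f y
involutive⇒distinct {f = f} inv x≢y e = x≢y (trans (sym (inv _)) (trans (cong f e) (inv _)))

module _ {V : Set} {G : Graph V} where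
  open Graph G

  Slides-swapHead : ∀ {xs ys} → Slides G xs ys → Slides G (swapHead xs) (swapHead ys)
  Slides-swapHead (slide {xs = []} e)    = slide e
  Slides-swapHead (slide {xs = _ ∷ _} e) = keep (slide e)
  Slides-swapHead (keep (slide e))       = slide e
  Slides-swapHead (keep (keep s))        = keep (keep s)

  Slides-swapTail : ∀ {xs ys} → Slides G xs ys → Slides G (swapTail xs) (swapTail ys)
  Slides-swapTail (slide e) = slide e
  Slides-swapTail (keep s)  = keep (Slides-swapHead s)

  All-swapHead : ∀ {P : V → Set} {xs} → All P xs → All P (swapHead xs)
  All-swapHead []           = []
  All-swapHead (p ∷ [])     = p ∷ []
  All-swapHead (p ∷ q ∷ ps) = q ∷ p ∷ ps

  Spread-swapHead : ∀ {xs} → Spread G xs → Spread G (swapHead xs)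
  Spread-swapHead []                       = []
  Spread-swapHead (a ∷ [])                 = a ∷ []
  Spread-swapHead ((a ∷ as) ∷ bs ∷ ps) = (Apart-sym G a ∷ bs) ∷ as ∷ ps

  Spread-swapTail : ∀ {xs} → Spread G xs → Spread G (swapTail xs)
  Spread-swapTail []       = []
  Spread-swapTail (a ∷ as) = All-swapHead a ∷ Spread-swapHead as

-- Excluding a change of the moving token

module _ {V : Set} (T : Graph V) (connected : Connected T) (acyclic : Acyclic T)
         (no2K₂+K₁ : ¬ InducedEmbedding 2K₂+K₁ T) (noD : ¬ InducedEmbedding (D 2 4 2) T) where
  open Graph T

  private
    ≁refl : ∀ {v} → ¬ v ~ v
    ≁refl = ~-irrefl refl

    Spread₃ : V → V → V → Set
    Spread₃ a b c = Spread T (a ∷ b ∷ c ∷ [])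

    ab : ∀ {a b c} → Spread₃ a b c → Apart T a b
    ab ((p ∷ _) ∷ _) = p
    ac : ∀ {a b c} → Spread₃ a b c → Apart T a c
    ac ((_ ∷ p ∷ _) ∷ _) = p
    bc : ∀ {a b c} → Spread₃ a b c → Apart T b c
    bc (_ ∷ (p ∷ _) ∷ _) = p

    swap₁₂ : ∀ {a b c} → Spread₃ a b c → Spread₃ b a c
    swap₁₂ {a} {b} {c} = Spread-swapHead {G = T} {xs = a ∷ b ∷ c ∷ []}
    swap₂₃ : ∀ {a b c} → Spread₃ a b c → Spread₃ a c b
    swap₂₃ {a} {b} {c} = Spread-swapTail {G = T} {xs = a ∷ b ∷ c ∷ []}

    rotˡ : ∀ {a b c} → Spread₃ a b c → Spread₃ b c a
    rotˡ = swap₂₃ ∘ swap₁₂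
    rotʳ : ∀ {a b c} → Spread₃ a b c → Spread₃ c a b
    rotʳ = swap₁₂ ∘ swap₂₃
    flip : ∀ {a b c} → Spread₃ a b c → Spread₃ c b a
    flip = swap₁₂ ∘ rotˡ

  no-closed-trail : ∀ {x ys} → GraphTrail T (x ∷ ys) → x ∈ ys → ⊥
  no-closed-trail = trail-fresh T acyclic

  -- Distinctness comes for free: if two of the vertices that must differ coincided, one of the
  -- given edges would contradict a non-adjacency.
  no-two-edges-and-vertex : ∀ {a b c d e} → a ~ b → c ~ d →
    ¬ a ~ c → ¬ a ~ d → ¬ b ~ c → ¬ b ~ d → ¬ e ~ a → ¬ e ~ b → ¬ e ~ c → ¬ e ~ d → ⊥
  no-two-edges-and-vertex {a} {b} {c} {d} {e} a~b c~d a≁c a≁d b≁c b≁d e≁a e≁b e≁c e≁d =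
    no2K₂+K₁ (+-embedding (+-embedding (edge a~b) (edge c~d) disjoint apart) vertex disjoint′ apart′)
    where
    edge : ∀ {x y} → x ~ y → InducedEmbedding (K 2) T
    edge {x} {y} x~y = K-embedding T (Vec.lookup (x ∷ y ∷ [])) λ
      { zero zero n → contradiction refl n ; zero (suc zero) _ → x~y
      ; (suc zero) zero _ → ~-sym x~y ; (suc zero) (suc zero) n → contradiction refl n }
    vertex : InducedEmbedding (K 1) T
    vertex = K-embedding T (λ _ → e) λ { zero zero n → contradiction refl n }
    disjoint : ∀ i j → Vec.lookup (a ∷ b ∷ []) i ≢ Vec.lookup (c ∷ d ∷ []) j
    disjoint zero       zero       refl = a≁d c~d
    disjoint zero       (suc zero) refl = a≁c (~-sym c~d)
    disjoint (suc zero) zero       refl = b≁d c~d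
    disjoint (suc zero) (suc zero) refl = b≁c (~-sym c~d)
    apart : ∀ i j → ¬ Vec.lookup (a ∷ b ∷ []) i ~ Vec.lookup (c ∷ d ∷ []) j
    apart zero       zero       = a≁c
    apart zero       (suc zero) = a≁d
    apart (suc zero) zero       = b≁c
    apart (suc zero) (suc zero) = b≁d
    disjoint′ : ∀ i (j : Fin 1) → InducedEmbedding.embed (+-embedding (edge a~b) (edge c~d) disjoint apart) i ≢ e
    disjoint′ (inj₁ zero)       _ refl = e≁b a~b
    disjoint′ (inj₁ (suc zero)) _ refl = e≁a (~-sym a~b)
    disjoint′ (inj₂ zero)       _ refl = e≁d c~d
    disjoint′ (inj₂ (suc zero)) _ refl = e≁c (~-sym c~d)
    apart′ : ∀ i (j : Fin 1) → ¬ InducedEmbedding.embed (+-embedding (edge a~b) (edge c~d) disjoint apart) i ~ e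
    apart′ (inj₁ zero)       _ = e≁a ∘ ~-sym
    apart′ (inj₁ (suc zero)) _ = e≁b ∘ ~-sym
    apart′ (inj₂ zero)       _ = e≁c ∘ ~-sym
    apart′ (inj₂ (suc zero)) _ = e≁d ∘ ~-sym

  -- The spine is `p q r s`, with leaves `a`, `a′` at `p` and `b`, `b′` at `s`. The inequalities
  -- concern only vertices two steps apart, since acyclicity turns an immersion of the double broom
  -- into an induced embedding.
  no-double-broom : ∀ {a a′ p q r s b b′} → a ~ p → a′ ~ p → p ~ q → q ~ r → r ~ s → s ~ b → s ~ b′ →
    a ≢ a′ → q ≢ a → q ≢ a′ → p ≢ r → q ≢ s → r ≢ b → r ≢ b′ → b ≢ b′ → ⊥
  no-double-broom {a} {a′} {p} {q} {r} {s} {b} {b′} a~p a′~p p~q q~r r~s s~b s~b′ a≢a′ q≢a q≢a′ p≢r q≢s r≢b r≢b′ b≢b′ =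
    noD (immersion⇒embedding
      (attachLeaves-connected {H = attachLeaves (P 4) Fin._≟_ zero 2} {_≟_ = Sum.≡-dec Fin._≟_ Fin._≟_}
        (attachLeaves-connected {H = P 4} {_≟_ = Fin._≟_} (P-connected 3)))
      (Sum.≡-dec (Sum.≡-dec Fin._≟_ Fin._≟_) Fin._≟_) acyclic
      (attachLeaves-immersion
        (attachLeaves-immersion path left left-inj (λ { zero → ~-sym a~p ; (suc zero) → ~-sym a′~p }) left-new)
        right right-inj (λ { zero → s~b ; (suc zero) → s~b′ })
        λ { i (inj₁ u) e → right-new i u e }))
    where
    spine : Fin 4 → V
    spine = Vec.lookup (p ∷ q ∷ r ∷ s ∷ [])
    left right : Fin 2 → V
    left  = Vec.lookup (a ∷ a′ ∷ [])
    right = Vec.lookup (b ∷ b′ ∷ [])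

    path : Immersion (P 4) T
    path = P-immersion spine next skip
      where
      next : ∀ i j → toℕ j ≡ suc (toℕ i) → spine i ~ spine j
      next zero             (suc zero)             _ = p~q
      next (suc zero)       (suc (suc zero))       _ = q~r
      next (suc (suc zero)) (suc (suc (suc zero))) _ = r~s
      skip : ∀ i j → toℕ j ≡ suc (suc (toℕ i)) → spine i ≢ spine j
      skip zero       (suc (suc zero))       _ = p≢r
      skip (suc zero) (suc (suc (suc zero))) _ = q≢s
    left-inj : ∀ {i j} → left i ≡ left j → i ≡ j
    left-inj {zero}     {zero}     _ = refl
    left-inj {zero}     {suc zero} e = contradiction e a≢a′
    left-inj {suc zero} {zero}     e = contradiction (sym e) a≢a′
    left-inj {suc zero} {suc zero} _ = refl
    right-inj : ∀ {i j} → right i ≡ right j → i ≡ j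
    right-inj {zero}     {zero}     _ = refl
    right-inj {zero}     {suc zero} e = contradiction e b≢b′
    right-inj {suc zero} {zero}     e = contradiction (sym e) b≢b′
    right-inj {suc zero} {suc zero} _ = refl
    left-new : ∀ i u → Graph._~_ (P 4) u zero → spine u ≢ left i
    left-new zero       (suc zero) (bwd _) = q≢a
    left-new (suc zero) (suc zero) (bwd _) = q≢a′
    right-new : ∀ i u → Graph._~_ (P 4) u (suc (suc (suc zero))) → spine u ≢ right i
    right-new zero       (suc (suc zero)) (fwd _) = r≢b
    right-new (suc zero) (suc (suc zero)) (fwd _) = r≢b′
    right-new i u (bwd e) = contradiction (Fin.toℕ<n u) (ℕ.<-irrefl e)

  neighbour : ∀ {u v} → u ≢ v → ∃ λ w → u ~ w
  neighbour {u} {v} u≢v with proj₂ connected u v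
  ... | ε     = contradiction refl u≢v
  ... | e ◅ _ = _ , e

  -- A token moving right after another one must stay next to the vertex just
  -- left: otherwise the two edges and the third token form an induced 2K₂ + K₁.
  crossing : ∀ {u v x x′ y} → Spread₃ u x y → u ~ v → Spread₃ v x y → x ~ x′ → Spread₃ v x′ y → u ~ x′
  crossing {u} {v} {x} {x′} uxy e vxy f vx′y with u ~? x′
  ... | yes u~x′ = u~x′
  ... | no u≁x′  = ⊥-elim (no-two-edges-and-vertex e f
    (proj₂ (ab uxy)) u≁x′ (proj₂ (ab vxy)) (proj₂ (ab vx′y))
    (proj₂ (ac uxy) ∘ ~-sym) (proj₂ (ac vxy) ∘ ~-sym) (proj₂ (bc vxy) ∘ ~-sym) (proj₂ (bc vx′y) ∘ ~-sym))

  -- The first token moves both before and after a move of the second. Applying `crossing` to both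
  -- turns closes the trail `v u x′ x w v`.
  no-return : ∀ {u v w x x′ y} → Spread₃ u x y → u ~ v → Spread₃ v x y → x ~ x′ → Spread₃ v x′ y →
    v ~ w → Spread₃ w x′ y → ⊥
  no-return {u} {v} {w} {x} {x′} uxy u~v vxy x~x′ vx′y v~w wx′y = no-closed-trail {ys = u ∷ x′ ∷ x ∷ w ∷ v ∷ []}
    ((~-sym u~v , proj₁ (ab vx′y)) ∷ (crossing uxy u~v vxy x~x′ vx′y , proj₁ (ab uxy)) ∷
     (~-sym x~x′ , ≢-sym (proj₁ (ab wx′y))) ∷
     (crossing (swap₁₂ vxy) x~x′ (swap₁₂ vx′y) v~w (swap₁₂ wx′y) , ≢-sym (proj₁ (ab vxy))) ∷ [ ~-sym v~w ])
    (there (there (there (there (here refl)))))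

  -- The order of movers is third, first, second, third. Three uses of `crossing` close the trail
  -- `y y₀ v u x′ x y′ y`.
  no-round : ∀ {u v x x′ y₀ y y′} → Spread₃ u x y₀ → y₀ ~ y → Spread₃ u x y → u ~ v → Spread₃ v x y →
    x ~ x′ → Spread₃ v x′ y → y ~ y′ → Spread₃ v x′ y′ → ⊥
  no-round {u} {v} {x} {x′} {y₀} {y} {y′} uxy₀ y₀~y uxy u~v vxy x~x′ vx′y y~y′ vx′y′ =
    no-closed-trail {ys = y₀ ∷ v ∷ u ∷ x′ ∷ x ∷ y′ ∷ y ∷ []}
    ((~-sym y₀~y , ≢-sym (proj₁ (ac vxy))) ∷
     (crossing (rotʳ uxy₀) y₀~y (rotʳ uxy) u~v (rotʳ vxy) , ≢-sym (proj₁ (ac uxy₀))) ∷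
     (~-sym u~v , proj₁ (ab vx′y)) ∷ (crossing uxy u~v vxy x~x′ vx′y , proj₁ (ab uxy)) ∷
     (~-sym x~x′ , proj₁ (bc vx′y′)) ∷
     (crossing (rotˡ vxy) x~x′ (rotˡ vx′y) y~y′ (rotˡ vx′y′) , proj₁ (bc vxy)) ∷ [ ~-sym y~y′ ])
    (there (there (there (there (there (there (here refl)))))))

  -- The order of movers is first, second, third, first. Three uses of `crossing` close the trail
  -- `v u x′ x y′ y z v`.
  no-third-first : ∀ {u v x x′ y y′ z} → Spread₃ u x y → u ~ v → Spread₃ v x y → x ~ x′ → Spread₃ v x′ y →
    y ~ y′ → Spread₃ v x′ y′ → v ~ z → Spread₃ z x′ y′ → ⊥
  no-third-first {u} {v} {x} {x′} {y} {y′} {z} uxy u~v vxy x~x′ vx′y y~y′ vx′y′ v~z zx′y′ =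
    no-closed-trail {ys = u ∷ x′ ∷ x ∷ y′ ∷ y ∷ z ∷ v ∷ []}
    ((~-sym u~v , proj₁ (ab vx′y)) ∷ (crossing uxy u~v vxy x~x′ vx′y , proj₁ (ab uxy)) ∷
     (~-sym x~x′ , proj₁ (bc vx′y′)) ∷
     (crossing (rotˡ vxy) x~x′ (rotˡ vx′y) y~y′ (rotˡ vx′y′) , proj₁ (bc vxy)) ∷
     (~-sym y~y′ , ≢-sym (proj₁ (ac zx′y′))) ∷
     (crossing (rotʳ vx′y) y~y′ (rotʳ vx′y′) v~z (rotʳ zx′y′) , ≢-sym (proj₁ (ac vxy))) ∷ [ ~-sym v~z ])
    (there (there (there (there (there (there (here refl)))))))

  -- This is the pattern of `no-return` for the second and third tokens; the closed trail is
  -- `x′ x y′ y z x′`.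
  no-third-second : ∀ {v x x′ y y′ z} → Spread₃ v x y → x ~ x′ → Spread₃ v x′ y →
    y ~ y′ → Spread₃ v x′ y′ → x′ ~ z → Spread₃ v z y′ → ⊥
  no-third-second {v} {x} {x′} {y} {y′} {z} vxy x~x′ vx′y y~y′ vx′y′ x′~z vzy′ =
    no-closed-trail {ys = x ∷ y′ ∷ y ∷ z ∷ x′ ∷ []}
    ((~-sym x~x′ , proj₁ (bc vx′y′)) ∷
     (crossing (rotˡ vxy) x~x′ (rotˡ vx′y) y~y′ (rotˡ vx′y′) , proj₁ (bc vxy)) ∷
     (~-sym y~y′ , ≢-sym (proj₁ (bc vzy′))) ∷
     (crossing (flip vx′y) y~y′ (flip vx′y′) x′~z (flip vzy′) , ≢-sym (proj₁ (bc vx′y))) ∷ [ ~-sym x′~z ])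
    (there (there (there (there (here refl)))))

  -- The only pattern that needs the double broom: two applications of `crossing` give the spine
  -- `u x′ x y′`. The first token swings between the leaves `a` and `v` across `u`, the third
  -- between `y` and `b` across `y′`.
  no-third-third : ∀ {a u v x x′ y y′ b} → a ~ u → a ≢ v → Spread₃ a x y → Spread₃ u x y → u ~ v → Spread₃ v x y →
    x ~ x′ → Spread₃ v x′ y → y ~ y′ → Spread₃ v x′ y′ → y′ ~ b → b ≢ y → Spread₃ v x′ b → ⊥
  no-third-third a~u a≢v axy uxy u~v vxy x~x′ vx′y y~y′ vx′y′ y′~b b≢y vx′b =
    no-double-broom a~u (~-sym u~v) (crossing uxy u~v vxy x~x′ vx′y) (~-sym x~x′)
      (crossing (rotˡ vxy) x~x′ (rotˡ vx′y) y~y′ (rotˡ vx′y′)) (~-sym y~y′) y′~b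
      a≢v (λ { refl → proj₂ (ab axy) (~-sym x~x′) }) (≢-sym (proj₁ (ab vx′y)))
      (proj₁ (ab uxy)) (proj₁ (bc vx′y′)) (proj₁ (bc vxy)) (λ { refl → proj₂ (bc vx′b) (~-sym x~x′) }) (≢-sym b≢y)

  -- If `x` and `y′` were adjacent, `v u x′ x y′` would be a path with `w` hanging off `x′`. The
  -- edges `u v` and `x y′` together with `w` would then induce 2K₂ + K₁.
  no-swing-right : ∀ {u v w x x′ y y′} → Spread₃ u x y → u ~ v → Spread₃ v x y → x ~ x′ → Spread₃ v x′ y →
    x′ ~ w → w ≢ x → Spread₃ v w y → y ~ y′ → ¬ x ~ y′
  no-swing-right {u} {v} {w} {x} {x′} {y} {y′} uxy u~v vxy x~x′ vx′y x′~w w≢x vwy y~y′ x~y′ =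
    no-two-edges-and-vertex u~v x~y′ (proj₂ (ab uxy)) u≁y′ (proj₂ (ab vxy)) v≁y′
      w≁u (proj₂ (ab vwy) ∘ ~-sym) w≁x w≁y′
    where
    u~x′ = crossing uxy u~v vxy x~x′ vx′y
    x′≢y′ : x′ ≢ y′
    x′≢y′ refl = proj₂ (bc vx′y) (~-sym y~y′)
    vux′xy′ : GraphTrail T (v ∷ u ∷ x′ ∷ x ∷ y′ ∷ [])
    vux′xy′ = (~-sym u~v , proj₁ (ab vx′y)) ∷ (u~x′ , proj₁ (ab uxy)) ∷ (~-sym x~x′ , x′≢y′) ∷ [ x~y′ ]
    wx′xy′ : GraphTrail T (w ∷ x′ ∷ x ∷ y′ ∷ [])
    wx′xy′ = (~-sym x′~w , w≢x) ∷ (~-sym x~x′ , x′≢y′) ∷ [ x~y′ ]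
    v≁y′ = trail-chordless T acyclic vux′xy′ (there (there (here refl)))
    u≁y′ : ¬ u ~ y′
    u≁y′ with vux′xy′
    ... | _ ∷ t = trail-chordless T acyclic t (there (here refl))
    w≁u : ¬ w ~ u
    w≁u w~u = no-closed-trail {ys = x′ ∷ u ∷ w ∷ []}
      ((~-sym x′~w , λ { refl → ≁refl w~u }) ∷ (~-sym u~x′ , λ { refl → ≁refl x′~w }) ∷ [ ~-sym w~u ])
      (there (there (here refl)))
    w≁x  = trail-chordless T acyclic wx′xy′ (here refl)
    w≁y′ = trail-chordless T acyclic wx′xy′ (there (here refl))

  -- The first token moves twice, then the second twice, while the third rests at `y`. Connectedness
  -- supplies a neighbour `y′` of `y`, and the edge `y y′` is played against `u v` and `x x′`:
  -- unless `x` or `v` is adjacent to `y′`, avoiding both induced copies of 2K₂ + K₁ makes `u`,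
  -- `x′`, `y′` a triangle.
  no-swing : ∀ {a u v w x x′ y} → a ~ u → a ≢ v → Spread₃ a x y → Spread₃ u x y → u ~ v → Spread₃ v x y →
    x ~ x′ → Spread₃ v x′ y → x′ ~ w → w ≢ x → Spread₃ v w y → ⊥
  no-swing {a} {u} {v} {w} {x} {x′} {y} a~u a≢v axy uxy u~v vxy x~x′ vx′y x′~w w≢x vwy
    with y′ , y~y′ ← neighbour (≢-sym (proj₁ (ac vxy))) = cases (x ~? y′) (v ~? y′) (u ~? y′) (x′ ~? y′)
    where
    u~x′ = crossing uxy u~v vxy x~x′ vx′y
    cases : Dec (x ~ y′) → Dec (v ~ y′) → Dec (u ~ y′) → Dec (x′ ~ y′) → ⊥
    cases (yes x~y′) _ _ _ = no-swing-right uxy u~v vxy x~x′ vx′y x′~w w≢x vwy y~y′ x~y′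
    -- Backwards in time the moves are `x′` to `x`, `v` to `u` and `u` to `a`, so `v` now plays the
    -- part of `x`, and `a` that of `w`.
    cases _ (yes v~y′) _ _ = no-swing-right (swap₁₂ vx′y) (~-sym x~x′) (swap₁₂ vxy) (~-sym u~v) (swap₁₂ uxy)
                               (~-sym a~u) a≢v (swap₁₂ axy) y~y′ v~y′
    cases (no x≁y′) (no v≁y′) (no u≁y′) _ = no-two-edges-and-vertex u~v y~y′
      (proj₂ (ac uxy)) u≁y′ (proj₂ (ac vxy)) v≁y′
      (proj₂ (ab uxy) ∘ ~-sym) (proj₂ (ab vxy) ∘ ~-sym) (proj₂ (bc vxy)) x≁y′
    cases (no x≁y′) (no v≁y′) _ (no x′≁y′) = no-two-edges-and-vertex x~x′ y~y′
      (proj₂ (bc vxy)) x≁y′ (proj₂ (bc vx′y)) x′≁y′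
      (proj₂ (ab vxy)) (proj₂ (ab vx′y)) (proj₂ (ac vxy)) v≁y′
    cases _ _ (yes u~y′) (yes x′~y′) = no-closed-trail {ys = x′ ∷ y′ ∷ u ∷ []}
      ((u~x′ , λ u≡y′ → ~-irrefl u≡y′ u~y′) ∷
       (x′~y′ , λ x′≡u → ~-irrefl (sym x′≡u) u~x′) ∷ [ ~-sym u~y′ ]) (there (there (here refl)))

  Window : List (List V) → Set
  Window cs = Trail (Slides T) _≢_ cs × All (Spread T) cs

  -- Read backwards in time, the two moves of a turn exchange their roles; this
  -- accounts for the swapped arguments.
  no-turn : ∀ {c₀ c₁ u v x x′ y c₅ c₆} →
    Window (c₀ ∷ c₁ ∷ (u ∷ x ∷ y ∷ []) ∷ (v ∷ x ∷ y ∷ []) ∷ (v ∷ x′ ∷ y ∷ []) ∷ c₅ ∷ c₆ ∷ []) →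
    u ~ v → x ~ x′ → ⊥
  -- The cases follow the tokens moving just before and just after the turn. If the second moved
  -- before, or the first moves after, one token moves on both sides of the other's move and
  -- `no-return` applies.
  no-turn ((_ ∷ (keep (slide h) , _) ∷ _) , _ ∷ uhy ∷ uxy ∷ vxy ∷ vx′y ∷ _) u~v x~x′ =
    no-return (swap₁₂ vx′y) (~-sym x~x′) (swap₁₂ vxy) (~-sym u~v) (swap₁₂ uxy) (~-sym h) (swap₁₂ uhy)
  no-turn ((_ ∷ _ ∷ _ ∷ _ ∷ (slide e , _) ∷ _) , _ ∷ _ ∷ uxy ∷ vxy ∷ vx′y ∷ wx′y ∷ _) u~v x~x′ =
    no-return uxy u~v vxy x~x′ vx′y e wx′y
  -- First before, second after. Configurations two moves apart differ, which here says that neither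
  -- double move backtracks: `a` differs from `v` and `w` from `x`.
  no-turn ((_ ∷ (slide a~u , n₁) ∷ _ ∷ (_ , n₃) ∷ (keep (slide x′~w) , _) ∷ _) , _ ∷ axy ∷ uxy ∷ vxy ∷ vx′y ∷ vwy ∷ _) u~v x~x′ =
    no-swing a~u (λ { refl → n₁ refl }) axy uxy u~v vxy x~x′ vx′y x′~w (λ { refl → n₃ refl }) vwy
  no-turn ((_ ∷ (keep (keep (slide y₀~y)) , _) ∷ _ ∷ _ ∷ (keep (keep (slide y~y′)) , _) ∷ _) ,
           _ ∷ uxy₀ ∷ uxy ∷ vxy ∷ vx′y ∷ vx′y′ ∷ _) u~v x~x′ =
    no-round uxy₀ y₀~y uxy u~v vxy x~x′ vx′y y~y′ vx′y′
  -- First before, third after: the next move as well is needed to decide.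
  no-turn ((_ ∷ (slide a~u , n₁) ∷ _ ∷ _ ∷ (keep (keep (slide y~y′)) , n₄) ∷ [ s ]) ,
           _ ∷ axy ∷ uxy ∷ vxy ∷ vx′y ∷ vx′y′ ∷ last ∷ []) u~v x~x′ with s
  ... | slide v~z        = no-third-first uxy u~v vxy x~x′ vx′y y~y′ vx′y′ v~z last
  ... | keep (slide x′~z) = no-third-second vxy x~x′ vx′y y~y′ vx′y′ x′~z last
  ... | keep (keep (slide y′~b)) =
    no-third-third a~u (λ { refl → n₁ refl }) axy uxy u~v vxy x~x′ vx′y y~y′ vx′y′ y′~b (λ { refl → n₄ refl }) last
  -- Third before, second after: the time reversal of the preceding case, so the earliest move of
  -- the window decides.
  no-turn (((s , n₀) ∷ (keep (keep (slide y₀~y)) , _) ∷ _ ∷ (_ , n₃) ∷ (keep (slide x′~w) , _) ∷ _) ,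
           first ∷ uxy₀ ∷ uxy ∷ vxy ∷ vx′y ∷ vwy ∷ _) u~v x~x′ with s
  ... | slide z~u        = no-third-second (swap₁₂ vxy) (~-sym u~v) (swap₁₂ uxy) (~-sym y₀~y) (swap₁₂ uxy₀)
                             (~-sym z~u) (swap₁₂ first)
  ... | keep (slide z~x) = no-third-first (swap₁₂ vx′y) (~-sym x~x′) (swap₁₂ vxy) (~-sym u~v) (swap₁₂ uxy) (~-sym y₀~y)
                             (swap₁₂ uxy₀) (~-sym z~x) (swap₁₂ first)
  ... | keep (keep (slide b~y₀)) =
    no-third-third (~-sym x′~w) (λ { refl → n₃ refl }) (swap₁₂ vwy) (swap₁₂ vx′y) (~-sym x~x′) (swap₁₂ vxy)
      (~-sym u~v) (swap₁₂ uxy) (~-sym y₀~y) (swap₁₂ uxy₀) (~-sym b~y₀) (λ { refl → n₀ refl }) (swap₁₂ first)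

  private
    permuteHead : ∀ {cs} → Window cs → Window (map swapHead cs)
    permuteHead (t , ss) =
      trail-map swapHead Slides-swapHead (involutive⇒distinct swapHead-involutive) t ,
      All.map⁺ (All.map (λ {xs} → Spread-swapHead {G = T} {xs}) ss)

    permuteTail : ∀ {cs} → Window cs → Window (map swapTail cs)
    permuteTail (t , ss) =
      trail-map swapTail Slides-swapTail (involutive⇒distinct swapTail-involutive) t ,
      All.map⁺ (All.map (λ {xs} → Spread-swapTail {G = T} {xs}) ss)

  -- Permuting the token positions reduces every turn to one where the first
  -- token moves and then the second.
  same-mover : ∀ {c₀ c₁ c₂ c₃ c₄ c₅ c₆} → Window (c₀ ∷ c₁ ∷ c₂ ∷ c₃ ∷ c₄ ∷ c₅ ∷ c₆ ∷ []) → length c₂ ≡ 3 →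
    (s : Slides T c₂ c₃) (s′ : Slides T c₃ c₄) → mover T s ≡ mover T s′
  same-mover {c₂ = _ ∷ _ ∷ _ ∷ []} w _ = turns w
    where
    turns : ∀ {c₀ c₁ u x y c₃ c₄ c₅ c₆} → Window (c₀ ∷ c₁ ∷ (u ∷ x ∷ y ∷ []) ∷ c₃ ∷ c₄ ∷ c₅ ∷ c₆ ∷ []) →
      (s : Slides T (u ∷ x ∷ y ∷ []) c₃) (s′ : Slides T c₃ c₄) → mover T s ≡ mover T s′
    turns _ (slide _)               (slide _)               = refl
    turns _ (keep (slide _))        (keep (slide _))        = refl
    turns _ (keep (keep (slide _))) (keep (keep (slide _))) = refl
    turns w (slide e)               (keep (slide f))        = ⊥-elim (no-turn w e f)
    turns w (keep (slide e))        (slide f)               = ⊥-elim (no-turn (permuteHead w) e f)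
    turns w (slide e)               (keep (keep (slide f))) = ⊥-elim (no-turn (permuteTail w) e f)
    turns w (keep (slide e))        (keep (keep (slide f))) =
      ⊥-elim (no-turn (permuteTail (permuteHead w)) e f)
    turns w (keep (keep (slide e))) (slide f)               =
      ⊥-elim (no-turn (permuteHead (permuteTail w)) e f)
    turns w (keep (keep (slide e))) (keep (slide f))        =
      ⊥-elim (no-turn (permuteTail (permuteHead (permuteTail w))) e f)

  -- The trail of a single moving token

  mover-position : ∀ {xs ys} (s : Slides T xs ys) → ∃₂ λ pre post → length pre ≡ mover T s × ∃ λ v → xs ≡ pre ++ v ∷ post
  mover-position (slide _) = [] , _ , refl , _ , refl
  mover-position (keep {x} s) with pre , post , eq , v , refl ← mover-position s = x ∷ pre , post , cong suc eq , v , refl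

  advance : ∀ pre {post xs ys v} → xs ≡ pre ++ v ∷ post → (s : Slides T xs ys) → length pre ≡ mover T s →
    ∃ λ v′ → v ~ v′ × ys ≡ pre ++ v′ ∷ post
  advance []        refl (slide v~v′) _  = _ , v~v′ , refl
  advance (x ∷ pre) refl (keep s)     eq with v′ , v~v′ , refl ← advance pre refl s (ℕ.suc-injective eq) = v′ , v~v′ , refl

  -- The entries of a spread list are distinct, which keeps `u` out of `pre` and `post` and leaves
  -- only the place of `w`. So when the occupied set recurs, the moving token is back at the same
  -- vertex.
  spread-position : ∀ pre {post u w} → Spread T (pre ++ u ∷ post) → u ∈ pre ++ w ∷ post → u ≡ w
  spread-position []        _        (here u≡w)  = u≡w
  spread-position []        (a ∷ _)  (there u∈)  = contradiction refl (proj₁ (All.lookup a u∈))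
  spread-position (_ ∷ pre) (a ∷ _)  (here refl) = contradiction refl (proj₁ (All.lookup a (∈-++⁺ʳ pre (here refl))))
  spread-position (_ ∷ pre) (_ ∷ as) (there u∈)  = spread-position pre as u∈

  applyUpTo-trail : (v : ℕ → V) → (∀ i → v i ~ v (suc i)) → (∀ i → v i ≢ v (suc (suc i))) →
    ∀ n → GraphTrail T (applyUpTo v (suc (suc n)))
  applyUpTo-trail v e n zero    = [ e 0 ]
  applyUpTo-trail v e n (suc m) = (e 0 , n 0) ∷ applyUpTo-trail (v ∘ suc) (e ∘ suc) (n ∘ suc) m

  -- All moves from index 2 on are made by one token, whose vertices therefore form a trail. The
  -- offset 2 gives the first turn considered the two earlier moves that a window requires.
  -- Recurrence is phrased by membership because a recurring vertex set might carry its tokens in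
  -- another order.
  never-recurs : (t : ℕ → List V) → (∀ i → Slides T (t i) (t (suc i))) → (∀ i → t i ≢ t (suc (suc i))) →
    (∀ i → Spread T (t i)) → (∀ i → length (t i) ≡ 3) →
    ∀ j d → ¬ (∀ {z} → z ∈ t (suc (suc (suc d ℕ.+ j))) → z ∈ t (suc (suc j)))
  never-recurs t slides advances spread length₃ j d recurs =
    no-closed-trail (applyUpTo-trail (λ i → vertex (i ℕ.+ j)) (λ i → edge (i ℕ.+ j)) (λ i → distinct (i ℕ.+ j)) d)
      (subst (_∈ applyUpTo (λ i → vertex (suc i ℕ.+ j)) (suc d)) revisit (∈-applyUpTo⁺ (λ i → vertex (suc i ℕ.+ j)) ℕ.≤-refl))
    where
    window : ∀ i → Window (applyUpTo (λ k → t (k ℕ.+ i)) 7)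
    window i =
      (slides _ , advances _) ∷ (slides _ , advances _) ∷ (slides _ , advances _) ∷ (slides _ , advances _) ∷
      (slides _ , advances _) ∷ [ slides _ ] ,
      spread _ ∷ spread _ ∷ spread _ ∷ spread _ ∷ spread _ ∷ spread _ ∷ spread _ ∷ []
    position = mover-position (slides 2)
    pre  = proj₁ position
    post = proj₁ (proj₂ position)
    moves : ∀ i → length pre ≡ mover T (slides (suc (suc i)))
    moves zero    = proj₁ (proj₂ (proj₂ position))
    moves (suc i) = trans (moves i) (same-mover (window i) (length₃ _) (slides _) (slides _))
    place : ∀ i → ∃ λ v → t (suc (suc i)) ≡ pre ++ v ∷ post
    place zero    = proj₂ (proj₂ (proj₂ position))
    place (suc i) with v , _ , eq ← advance pre (proj₂ (place i)) (slides _) (moves i) = v , eq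
    vertex : ℕ → V
    vertex i = proj₁ (place i)
    edge : ∀ i → vertex i ~ vertex (suc i)
    edge i = proj₁ (proj₂ (advance pre (proj₂ (place i)) (slides _) (moves i)))
    distinct : ∀ i → vertex i ≢ vertex (suc (suc i))
    -- The other tokens rest, so a moving token back after two moves would restore the whole
    -- configuration.
    distinct i e = advances _ (trans (proj₂ (place i))
      (trans (cong (λ v → pre ++ v ∷ post) e) (sym (proj₂ (place (suc (suc i)))))))
    revisit : vertex (suc d ℕ.+ j) ≡ vertex j
    revisit = spread-position pre (subst (Spread T) (proj₂ (place (suc d ℕ.+ j))) (spread _))
      (subst (vertex (suc d ℕ.+ j) ∈_) (proj₂ (place j))
        (recurs (subst (vertex (suc d ℕ.+ j) ∈_) (sym (proj₂ (place (suc d ℕ.+ j)))) (∈-++⁺ʳ pre (here refl)))))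

-- Token lists and the vertex sets they occupy

fromList : ∀ {n} → List (Fin n) → Subset n
fromList []       = Subset.⊥
fromList (x ∷ xs) = ⁅ x ⁆ ∪ fromList xs

∈-fromList⁺ : ∀ {n} {xs : List (Fin n)} {z} → z ∈ xs → z Subset.∈ fromList xs
∈-fromList⁺ (here refl) = Subset.x∈p∪q⁺ (inj₁ (Subset.x∈⁅x⁆ _))
∈-fromList⁺ (there z∈)  = Subset.x∈p∪q⁺ (inj₂ (∈-fromList⁺ z∈))

∈-fromList⁻ : ∀ {n} (xs : List (Fin n)) {z} → z Subset.∈ fromList xs → z ∈ xs
∈-fromList⁻ []       z∈ = contradiction z∈ Subset.∉⊥
∈-fromList⁻ (x ∷ xs) z∈ with Subset.x∈p∪q⁻ ⁅ x ⁆ (fromList xs) z∈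
... | inj₁ z∈⁅x⁆ = here (Subset.x∈⁅y⁆⇒x≡y x z∈⁅x⁆)
... | inj₂ z∈xs  = there (∈-fromList⁻ xs z∈xs)

∣⁅x⁆∪S∣ : ∀ {n} (x : Fin n) (S : Subset n) → x Subset.∉ S → ∣ ⁅ x ⁆ ∪ S ∣ ≡ suc ∣ S ∣
∣⁅x⁆∪S∣ zero    (inside  ∷ S) x∉S = contradiction here x∉S
∣⁅x⁆∪S∣ zero    (outside ∷ S) x∉S = cong (suc ∘ ∣_∣) (Subset.∪-identityˡ S)
∣⁅x⁆∪S∣ (suc x) (inside  ∷ S) x∉S = cong suc (∣⁅x⁆∪S∣ x S (x∉S ∘ there))
∣⁅x⁆∪S∣ (suc x) (outside ∷ S) x∉S = ∣⁅x⁆∪S∣ x S (x∉S ∘ there)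

∣fromList∣ : ∀ {n} {xs : List (Fin n)} → Unique xs → ∣ fromList xs ∣ ≡ length xs
∣fromList∣ {n} [] = Subset.∣⊥∣≡0 n
∣fromList∣ {xs = x ∷ xs} (x∉ ∷ u) =
  trans (∣⁅x⁆∪S∣ x (fromList xs) (All¬⇒¬Any x∉ ∘ ∈-fromList⁻ xs)) (cong suc (∣fromList∣ u))

x∈p─q⇒x∉q : ∀ {n} {x : Fin n} (p q : Subset n) → x Subset.∈ p ─ q → x Subset.∉ q
x∈p─q⇒x∉q (inside ∷ p) (outside ∷ q) here          ()
x∈p─q⇒x∉q (_ ∷ p)      (inside ∷ q)  (there x∈p─q) (there x∈q) = x∈p─q⇒x∉q p q x∈p─q x∈q
x∈p─q⇒x∉q (_ ∷ p)      (outside ∷ q) (there x∈p─q) (there x∈q) = x∈p─q⇒x∉q p q x∈p─q x∈q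

-- The list orders the tokens on `S`. Its positions record the identity of each token along a walk,
-- which the subset alone forgets.
record Occupies {n} (xs : List (Fin n)) (S : Subset n) : Set where
  field
    unique   : Unique xs
    sound    : ∀ {z} → z ∈ xs → z Subset.∈ S
    complete : ∀ {z} → z Subset.∈ S → z ∈ xs

open Occupies

occupants : ∀ {n} (S : Subset n) → ∃ λ xs → Occupies xs S
occupants {n} S = filter (Subset._∈? S) (allFin n) , record
  { unique   = Unique.filter⁺ (Subset._∈? S) (Unique.allFin⁺ n)
  ; sound    = proj₂ ∘ ∈-filter⁻ (Subset._∈? S) {xs = allFin n}
  ; complete = λ {z} → ∈-filter⁺ (Subset._∈? S) (∈-allFin z)
  }

fromList-occupants : ∀ {n} {xs : List (Fin n)} {S} → Occupies xs S → fromList xs ≡ S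
fromList-occupants {xs = xs} o = Subset.⊆-antisym (sound o ∘ ∈-fromList⁻ xs) (∈-fromList⁺ ∘ complete o)

length-occupants : ∀ {n} {xs : List (Fin n)} {S} → Occupies xs S → length xs ≡ ∣ S ∣
length-occupants o = trans (sym (∣fromList∣ (unique o))) (cong ∣_∣ (fromList-occupants o))

spread : ∀ {V : Set} (G : Graph V) {xs} → Unique xs → (∀ {u v} → u ∈ xs → v ∈ xs → ¬ Graph._~_ G u v) → Spread G xs
spread G []       _   = []
spread G (x∉ ∷ u) ind = All.tabulate (λ v∈ → All.lookup x∉ v∈ , ind (here refl) (there v∈))
                      ∷ spread G u (λ u∈ v∈ → ind (there u∈) (there v∈))

spread-independent : ∀ {V : Set} (G : Graph V) {xs} → Spread G xs → ∀ {u v} → u ∈ xs → v ∈ xs → ¬ Graph._~_ G u v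
spread-independent G (a ∷ as) (here refl) (here refl) = Graph.~-irrefl G refl
spread-independent G (a ∷ as) (here refl) (there v∈)  = proj₂ (All.lookup a v∈)
spread-independent G (a ∷ as) (there u∈)  (here refl) = proj₂ (All.lookup a u∈) ∘ Graph.~-sym G
spread-independent G (a ∷ as) (there u∈)  (there v∈)  = spread-independent G as u∈ v∈

module _ {V : Set} (G : Graph V) where
  open Graph G

  -- The token on `u` is replaced in place, so every other token keeps its position; the last two
  -- components determine the new occupied set.
  slide-token : ∀ {xs u v} → Unique xs → u ∈ xs → v ∉ xs → u ~ v →
    ∃ λ ys → Slides G xs ys × Unique ys × v ∈ ys × (∀ {z} → z ∈ ys → z ≡ v ⊎ (z ∈ xs × z ≢ u)) ×
             (∀ {z} → z ∈ xs → z ≢ u → z ∈ ys)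
  slide-token (u∉ ∷ un) (here refl) v∉ u~v =
    _ , slide u~v , ¬Any⇒All¬ _ (v∉ ∘ there) ∷ un , here refl ,
    (λ { (here z≡v) → inj₁ z≡v ; (there z∈) → inj₂ (there z∈ , λ { refl → All.lookup u∉ z∈ refl }) }) ,
    λ { (here z≡u) z≢u → contradiction z≡u z≢u ; (there z∈) _ → there z∈ }
  slide-token {x ∷ xs} {u} {v} (x∉ ∷ un) (there u∈) v∉ u~v
    with ys , s , un′ , v∈ , to , from ← slide-token un u∈ (v∉ ∘ there) u~v =
    x ∷ ys , keep s , ¬Any⇒All¬ _ x∉ys ∷ un′ , there v∈ ,
    (λ { (here refl) → inj₂ (here refl , All.lookup x∉ u∈)
       ; (there z∈) → Sum.map₂ (λ (z∈xs , z≢u) → there z∈xs , z≢u) (to z∈) }) ,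
    λ { (here z≡x) _ → here z≡x ; (there z∈) z≢u → there (from z∈ z≢u) }
    where
    x∉ys : x ∉ ys
    x∉ys x∈ with to x∈
    ... | inj₁ x≡v        = v∉ (here (sym x≡v))
    ... | inj₂ (x∈xs , _) = All.lookup x∉ x∈xs refl

  exchange : ∀ {xs ys} → Unique xs → Unique ys → Slides G xs ys →
    ∃₂ λ u v → u ~ v × (u ∈ xs × u ∉ ys × ∀ {z} → z ∈ xs → z ∉ ys → z ≡ u) ×
                       (v ∈ ys × v ∉ xs × ∀ {z} → z ∈ ys → z ∉ xs → z ≡ v)
  exchange (u∉ ∷ _) (v∉ ∷ _) (slide u~v) = _ , _ , u~v ,
    (here refl , (λ { (here u≡v) → ~-irrefl u≡v u~v ; (there u∈) → All.lookup u∉ u∈ refl }) ,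
      λ { (here z≡u) _ → z≡u ; (there z∈) z∉ → contradiction (there z∈) z∉ }) ,
    (here refl , (λ { (here v≡u) → ~-irrefl (sym v≡u) u~v ; (there v∈) → All.lookup v∉ v∈ refl }) ,
      λ { (here z≡v) _ → z≡v ; (there z∈) z∉ → contradiction (there z∈) z∉ })
  exchange (x∉ ∷ un) (x∉′ ∷ un′) (keep s)
    with u , v , u~v , (u∈ , u∉ , only-u) , (v∈ , v∉ , only-v) ← exchange un un′ s = u , v , u~v ,
    (there u∈ , (λ { (here refl) → All.lookup x∉ u∈ refl ; (there u∈′) → u∉ u∈′ }) ,
      λ { (here z≡x) z∉ → contradiction (here z≡x) z∉ ; (there z∈) z∉ → only-u z∈ (z∉ ∘ there) }) ,
    (there v∈ , (λ { (here refl) → All.lookup x∉′ v∈ refl ; (there v∈′) → v∉ v∈′ }) ,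
      λ { (here z≡x) z∉ → contradiction (here z≡x) z∉ ; (there z∈) z∉ → only-v z∈ (z∉ ∘ there) })

-- From a cycle of token sets to a walk of labelled tokens

cyclicSuc : ∀ {n} → Fin (suc n) → Fin (suc n)
cyclicSuc i with view i
... | ‵fromℕ     = zero
... | ‵inject₁ j = suc j

module _ {V : Set} {G : Graph V} (C : Cycle G) where
  open Graph G
  open Cycle C

  cyclicSuc-step : ∀ i → vertex i ~ vertex (cyclicSuc i)
  cyclicSuc-step i with view i
  ... | ‵fromℕ     = closing
  ... | ‵inject₁ j = step j

-- Here it matters that a cycle has at least three vertices: walking around it never backtracks.
cyclicSuc²-distinct : ∀ {n} (i : Fin (suc (suc (suc n)))) → i ≢ cyclicSuc (cyclicSuc i)
cyclicSuc²-distinct i with view i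
... | ‵fromℕ     = λ ()
... | ‵inject₁ j with view j
...   | ‵fromℕ     = λ ()
...   | ‵inject₁ k = λ e → ℕ.<⇒≢ (ℕ.m<n⇒m<1+n ℕ.≤-refl)
  (trans (sym (trans (Fin.toℕ-inject₁ (inject₁ k)) (Fin.toℕ-inject₁ k))) (cong toℕ e))

module _ {n} (T : Graph (Fin n)) where
  open Graph T

  -- The conditions on a node are irrelevant and have to be recovered: independence because it is a
  -- negation, the size below because equality of numbers is decidable.
  node-independent : ∀ {k} (I : IndependentSet T k) → Independent T (value I)
  node-independent (S , [ p ]) u v u∈ v∈ u~v = ⊥-elim-irr (proj₂ p u v u∈ v∈ u~v)

  node-size : ∀ {k} (I : IndependentSet T k) → ∣ value I ∣ ≡ k
  node-size {k} (S , [ p ]) = recompute (∣ S ∣ ℕ.≟ k) (proj₁ p)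

  -- The two singleton differences say that `J` arises from `I` by exchanging `u` for `v`, so the
  -- token on `u` can be moved in any given ordering of `I`.
  lift-slide : ∀ {k} (I J : IndependentSet T k) → Graph._~_ (TS k T) I J →
    ∀ {xs} → Occupies xs (value I) → ∃ λ ys → Slides T xs ys × Occupies ys (value J)
  lift-slide I J (u , v , I─J≡u , J─I≡v , u~v) {xs} o = lifted
    where
    u∈I─J = subst (u Subset.∈_) (sym I─J≡u) (Subset.x∈⁅x⁆ u)
    v∈J─I = subst (v Subset.∈_) (sym J─I≡v) (Subset.x∈⁅x⁆ v)
    v∈J = Subset.p─q⊆p (value J) (value I) v∈J─I
    lifted : ∃ λ ys → Slides T xs ys × Occupies ys (value J)
    lifted with ys , s , un , v∈ys , to , from ←
      slide-token T (unique o) (complete o (Subset.p─q⊆p (value I) (value J) u∈I─J))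
        (x∈p─q⇒x∉q (value J) (value I) v∈J─I ∘ sound o) u~v
      = ys , s , record { unique = un ; sound = sound′ ; complete = complete′ }
      where
      sound′ : ∀ {z} → z ∈ ys → z Subset.∈ value J
      sound′ {z} z∈ys with to z∈ys | z Subset.∈? value J
      ... | inj₁ refl         | _       = v∈J
      ... | inj₂ _            | yes z∈J = z∈J
      ... | inj₂ (z∈xs , z≢u) | no z∉J  = contradiction
        (Subset.x∈⁅y⁆⇒x≡y u (subst (z Subset.∈_) I─J≡u (Subset.x∈p∧x∉q⇒x∈p─q (sound o z∈xs) z∉J))) z≢u
      complete′ : ∀ {z} → z Subset.∈ value J → z ∈ ys
      complete′ {z} z∈J with z Subset.∈? value I
      ... | yes z∈I = from (complete o z∈I) λ { refl → x∈p─q⇒x∉q (value I) (value J) u∈I─J z∈J }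
      ... | no z∉I  = subst (_∈ ys) (sym
        (Subset.x∈⁅y⁆⇒x≡y v (subst (z Subset.∈_) J─I≡v (Subset.x∈p∧x∉q⇒x∈p─q z∈J z∉I)))) v∈ys

  lift-walk : ∀ {k} (I : ℕ → IndependentSet T k) → (∀ i → Graph._~_ (TS k T) (I i) (I (suc i))) →
    ∃ λ (t : ℕ → List (Fin n)) → (∀ i → Occupies (t i) (value (I i))) × (∀ i → Slides T (t i) (t (suc i)))
  lift-walk I step = proj₁ ∘ tokens , proj₂ ∘ tokens , λ i → proj₁ (proj₂ (next i (proj₂ (tokens i))))
    where
    next : ∀ i {xs} → Occupies xs (value (I i)) → ∃ λ ys → Slides T xs ys × Occupies ys (value (I (suc i)))
    next i = lift-slide (I i) (I (suc i)) (step i)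
    tokens : ∀ i → ∃ λ xs → Occupies xs (value (I i))
    tokens zero    = occupants _
    tokens (suc i) = _ , proj₂ (proj₂ (next i (proj₂ (tokens i))))

node-≡ : ∀ {n k} {T : Graph (Fin n)} {I J : IndependentSet T k} → value I ≡ value J → I ≡ J
node-≡ {I = S , _} {J = S , _} refl = refl

module _ {n} (T : Graph (Fin n)) (tree : IsTree T)
         (no2K₂+K₁ : ¬ InducedEmbedding 2K₂+K₁ T) (noD : ¬ InducedEmbedding (D 2 4 2) T) where

  TS₃-acyclic : Acyclic (TS 3 T)
  -- The cycle is walked around forever. Among one more step than it has vertices, counted from
  -- index 2 as `never-recurs` requires, some node repeats.
  TS₃-acyclic C = recurrence (Fin.pigeonhole ℕ.≤-refl (λ i → position (suc (suc (toℕ i)))))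
    where
    open Cycle C
    position : ℕ → Fin (suc (suc (suc excess)))
    position zero    = zero
    position (suc i) = cyclicSuc (position i)
    I : ℕ → IndependentSet T 3
    I = vertex ∘ position
    recurrence : ¬ (∃₂ λ i j → toℕ i < toℕ j × position (suc (suc (toℕ i))) ≡ position (suc (suc (toℕ j))))
    recurrence (i , j , i<j , eq) with t , occ , slides ← lift-walk T I (λ i → cyclicSuc-step C (position i)) =
      never-recurs T (proj₁ tree) (proj₂ tree) no2K₂+K₁ noD t slides advances spreads lengths (toℕ i) d
        (subst (λ k → ∀ {z} → z ∈ t (suc (suc k)) → z ∈ t (suc (suc (toℕ i)))) j≡ recurs)
      where
      advances : ∀ i → t i ≢ t (suc (suc i))
      advances i e = cyclicSuc²-distinct (position i) (injective (node-≡ {T = T} {I = I i} {J = I (suc (suc i))}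
        (trans (sym (fromList-occupants (occ i))) (trans (cong fromList e) (fromList-occupants (occ (suc (suc i))))))))
      spreads : ∀ i → Spread T (t i)
      spreads i = spread T (unique (occ i)) λ u∈ v∈ → node-independent T (I i) _ _ (sound (occ i) u∈) (sound (occ i) v∈)
      lengths : ∀ i → length (t i) ≡ 3
      lengths i = trans (length-occupants (occ i)) (node-size T (I i))
      d = toℕ j ∸ suc (toℕ i)
      j≡ : toℕ j ≡ suc d ℕ.+ toℕ i
      j≡ = trans (sym (ℕ.m∸n+n≡m i<j)) (ℕ.+-suc d (toℕ i))
      recurs : ∀ {z} → z ∈ t (suc (suc (toℕ j))) → z ∈ t (suc (suc (toℕ i)))
      recurs {z} = complete (occ (suc (suc (toℕ i)))) ∘ subst (λ p → z Subset.∈ value (vertex p)) (sym eq) ∘ sound (occ (suc (suc (toℕ j))))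

-- Closed token walks in the forbidden graphs

-- A decidable sufficient condition for occupying different sets, and one that embeddings preserve.
Differs : {V : Set} → Rel (List V) _
Differs xs ys = Any (_∉ ys) xs

differs? : {V : Set} → DecidableEquality V → Decidable (Differs {V})
differs? _≟_ xs ys = Any.any? (λ x → ¬? (x ∈? ys)) xs
  where open DecMembership _≟_ using (_∈?_)

-- Deciding trails lets the explicit walks below be checked by evaluation.
trail? : ∀ {A : Set} {R N : Rel A _} → Decidable R → Decidable N → ∀ xs → Dec (Trail R N xs)
trail? R? N? []           = no λ ()
trail? R? N? (_ ∷ [])     = no λ ()
trail? R? N? (x ∷ y ∷ []) = map′ [_] (λ { [ r ] → r }) (R? x y)
trail? R? N? (x ∷ y ∷ z ∷ zs) =
  map′ (λ (r , t) → r ∷ t) (λ { (r ∷ t) → r , t }) ((R? x y ×-dec N? x z) ×-dec trail? R? N? (y ∷ z ∷ zs))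

module _ {W : Set} (H : Graph W) (_≟_ : DecidableEquality W) where
  open Graph H

  Spread? : ∀ xs → Dec (Spread H xs)
  Spread? = AllPairs.allPairs? λ u v → ¬? (u ≟ v) ×-dec ¬? (u ~? v)

  slides? : Decidable (Slides H)
  slides? []       _        = no λ ()
  slides? (_ ∷ _)  []       = no λ ()
  slides? (u ∷ xs) (v ∷ ys) = map′
    (λ { (inj₁ (u~v , refl)) → slide u~v ; (inj₂ (refl , s)) → keep s })
    (λ { (slide u~v) → inj₁ (u~v , refl) ; (keep s) → inj₂ (refl , s) })
    ((u ~? v ×-dec ≡-dec _≟_ xs ys) ⊎-dec (u ≟ v ×-dec slides? xs ys))

-- Plays the part of a node of TS for a graph whose vertex type need not be `Fin n`, such as the
-- forbidden graphs.
Tokens : {W : Set} → Graph W → ℕ → Set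
Tokens {W} H k = Σ (List W) λ xs → Spread H xs × length xs ≡ k

module _ {n} {T : Graph (Fin n)} {W : Set} {H : Graph W} (E : InducedEmbedding H T) where
  open InducedEmbedding E

  embed-spread : ∀ {xs} → Spread H xs → Spread T (map embed xs)
  embed-spread = AllPairs.map⁺ ∘ AllPairs.map λ (u≢v , u≁v) →
    (u≢v ∘ injective) , u≁v ∘ Equivalence.from (adjacency _ _)

  embed-slides : ∀ {xs ys} → Slides H xs ys → Slides T (map embed xs) (map embed ys)
  embed-slides (slide u~v) = slide (Equivalence.to (adjacency _ _) u~v)
  embed-slides (keep s)    = keep (embed-slides s)

  embed-differs : ∀ {xs ys} → Differs xs ys → Differs (map embed xs) (map embed ys)
  embed-differs {xs} {ys} d with x , x∈ , x∉ ← find d = lose (∈-map⁺ embed x∈) λ fx∈ →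
    let y , y∈ , fx≡fy = ∈-map⁻ embed fx∈ in x∉ (subst (_∈ ys) (sym (injective fx≡fy)) y∈)

module _ {n} (T : Graph (Fin n)) {k : ℕ} where
  open Graph T

  node : Tokens T k → IndependentSet T k
  node (xs , s , l) = fromList xs ,
    [ (trans (∣fromList∣ (AllPairs.map proj₁ s)) l , λ u v u∈ v∈ → spread-independent T s (∈-fromList⁻ xs u∈) (∈-fromList⁻ xs v∈)) ]

  node-slide : ∀ {c d} → Slides T (proj₁ c) (proj₁ d) → Graph._~_ (TS k T) (node c) (node d)
  node-slide {xs , sx , _} {ys , sy , _} s
    with u , v , u~v , left , entered ← exchange T (AllPairs.map proj₁ sx) (AllPairs.map proj₁ sy) s =
    u , v , difference left , difference entered , u~v
    where
    difference : ∀ {xs ys u} → u ∈ xs × u ∉ ys × (∀ {z} → z ∈ xs → z ∉ ys → z ≡ u) → fromList xs ─ fromList ys ≡ ⁅ u ⁆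
    difference {xs} {ys} {u} (u∈ , u∉ , only-u) = Subset.⊆-antisym
      (λ z∈ → subst (Subset._∈ ⁅ u ⁆) (sym (only-u (∈-fromList⁻ xs (Subset.p─q⊆p (fromList xs) (fromList ys) z∈))
        (x∈p─q⇒x∉q (fromList xs) (fromList ys) z∈ ∘ ∈-fromList⁺))) (Subset.x∈⁅x⁆ u))
      (λ z∈ → subst (Subset._∈ _) (sym (Subset.x∈⁅y⁆⇒x≡y u z∈))
        (Subset.x∈p∧x∉q⇒x∈p─q (∈-fromList⁺ u∈) (u∉ ∘ ∈-fromList⁻ ys)))

  node-differs : ∀ {c d} → Differs (proj₁ c) (proj₁ d) → node c ≢ node d
  node-differs {xs , _} {ys , _} diff e with x , x∈ , x∉ ← find diff =
    x∉ (∈-fromList⁻ ys (subst (x Subset.∈_) (cong value e) (∈-fromList⁺ x∈)))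

module _ {n} {T : Graph (Fin n)} {W : Set} {H : Graph W} {k : ℕ} where

  embed-tokens : InducedEmbedding H T → Tokens H k → Tokens T k
  embed-tokens E (xs , s , l) = map embed xs , embed-spread E s , trans (length-map embed xs) l
    where open InducedEmbedding E

  -- An embedding carries the closed walk of tokens in `H` to a closed trail of `TS k T`, which
  -- freshness of trails forbids.
  closed-walk⇒¬acyclic : ∀ {c cs} → c ∈ cs →
    Trail {Tokens H k} (λ c d → Slides H (proj₁ c) (proj₁ d)) (λ c d → Differs (proj₁ c) (proj₁ d)) (c ∷ cs) →
    Acyclic (TS k T) → ¬ InducedEmbedding H T
  closed-walk⇒¬acyclic {c} {cs} c∈cs walk acyclic E =
    trail-fresh (TS k T) acyclic (trail-map f
      (λ {c} {d} s → node-slide T {c = embed-tokens E c} {embed-tokens E d} (embed-slides E s))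
      (λ {c} {d} s → node-differs T {c = embed-tokens E c} {embed-tokens E d} (embed-differs E s)) walk)
      (∈-map⁺ f c∈cs)
    where
    f : Tokens H k → IndependentSet T k
    f = node T ∘ embed-tokens E

module _ {n} {T : Graph (Fin n)} (acyclic : Acyclic (TS 3 T)) where

  -- Two tokens move alternately, each on its own edge, while the third rests on the isolated
  -- vertex. This closes up after four moves.
  acyclic⇒2K₂+K₁-free : ¬ InducedEmbedding 2K₂+K₁ T
  acyclic⇒2K₂+K₁-free = closed-walk⇒¬acyclic (∈-++⁺ʳ (_ ∷ _ ∷ _ ∷ []) (here refl))
    (toWitness {a? = trail? (λ c d → slides? 2K₂+K₁ _≟_ (proj₁ c) (proj₁ d))
                           (λ c d → differs? _≟_ (proj₁ c) (proj₁ d))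
      (place a c ∷ place b c ∷ place b d ∷ place a d ∷ place a c ∷ [])} _) acyclic
    where
    _≟_ : DecidableEquality ((Fin 2 ⊎ Fin 2) ⊎ Fin 1)
    _≟_ = Sum.≡-dec (Sum.≡-dec Fin._≟_ Fin._≟_) Fin._≟_
    a = inj₁ (inj₁ zero)
    b = inj₁ (inj₁ (suc zero))
    c = inj₁ (inj₂ zero)
    d = inj₁ (inj₂ (suc zero))
    e = inj₂ zero
    place : ∀ u v {_ : True (Spread? 2K₂+K₁ _≟_ (u ∷ v ∷ e ∷ []))} → Tokens 2K₂+K₁ 3
    place u v {s} = _ , toWitness s , refl

  -- The middle token shuttles between `p₂` and `p₃`. While it is on `p₃` the first token can swing
  -- between `a` and `a′` through `p₁`; while it is on `p₂` the last can swing between `b` and `b′`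
  -- through `p₄`. Alternating these swings returns to the start after twelve moves.
  acyclic⇒D-free : ¬ InducedEmbedding (D 2 4 2) T
  acyclic⇒D-free = closed-walk⇒¬acyclic
    (∈-++⁺ʳ (_ ∷ _ ∷ _ ∷ _ ∷ _ ∷ _ ∷ _ ∷ _ ∷ _ ∷ _ ∷ _ ∷ []) (here refl))
    (toWitness {a? = trail? (λ c d → slides? (D 2 4 2) _≟_ (proj₁ c) (proj₁ d))
                           (λ c d → differs? _≟_ (proj₁ c) (proj₁ d))
      (place p₁ p₃ b  ∷ place a  p₃ b  ∷ place a  p₂ b  ∷ place a  p₂ p₄ ∷ place a  p₂ b′ ∷ place a  p₃ b′ ∷
       place p₁ p₃ b′ ∷ place a′ p₃ b′ ∷ place a′ p₂ b′ ∷ place a′ p₂ p₄ ∷ place a′ p₂ b  ∷ place a′ p₃ b  ∷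
       place p₁ p₃ b  ∷ [])} _) acyclic
    where
    _≟_ : DecidableEquality ((Fin 4 ⊎ Fin 2) ⊎ Fin 2)
    _≟_ = Sum.≡-dec (Sum.≡-dec Fin._≟_ Fin._≟_) Fin._≟_
    p₁ = inj₁ (inj₁ zero)
    p₂ = inj₁ (inj₁ (suc zero))
    p₃ = inj₁ (inj₁ (suc (suc zero)))
    p₄ = inj₁ (inj₁ (suc (suc (suc zero))))
    a  = inj₁ (inj₂ zero)
    a′ = inj₁ (inj₂ (suc zero))
    b  = inj₂ zero
    b′ = inj₂ (suc zero)
    place : ∀ u v w {_ : True (Spread? (D 2 4 2) _≟_ (u ∷ v ∷ w ∷ []))} → Tokens (D 2 4 2) 3
    place u v w {s} = _ , toWitness s , refl

proposition5 : (n : ℕ) (T : Graph (Fin n)) → IsTree T →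
    Acyclic (TS 3 T) ⇔ (((_ , 2K₂+K₁) ∷ (_ , D 2 4 2) ∷ []) -Free T)
proposition5 n T tree = mk⇔
  (λ acyclic → acyclic⇒2K₂+K₁-free acyclic ∷ acyclic⇒D-free acyclic ∷ [])
  (λ { (no2K₂+K₁ ∷ noD ∷ []) → TS₃-acyclic T tree no2K₂+K₁ noD })
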